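{- Let $p\ge 4$ be an integer and let $T_1$ be the tree obtained from an induced path $a_1\text{ - }a_2\text{ - }\cdots\text{ - }a_p$ by adding three new vertices $x,z,y$ and the edges $a_px$, $xz$ and $a_py$. For every integer $d\ge 1$ (and every such $T_1$) there exists a polynomial $f$ such that for every integer $t\ge 1$ the following holds: if $G$ is a paw-free graph that is $T_1$-free and does not contain $K_d(t)$ as a subgraph, then $\chi(G)\le f(t)$.
   Context: All graphs are finite and simple. $\chi(G)$ is the chromatic number of $G$. A graph is $H$-free if it has no induced subgraph isomorphic to $H$. The paw is the graph on four vertices consisting of a triangle together with one additional vertex adjacent to exactly one vertex of the triangle. For integers $d,t\ge1$, $K_d(t)$ denotes the complete $d$-partite graph in which each of the $d$ parts has exactly $t$ vertices; "contains $K_d(t)$ as a subgraph" means as a (not necessarily induced) subgraph. -}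

module Defs where

open import Data.Fin using (Fin; toℕ; finToFun; funToFin)
open import Data.Fin.Properties using (any?; all?; finToFun-funToFin) renaming (_≟_ to _≟ᶠ_)
open import Data.Integer using (ℤ; 0ℤ; _+_; _*_)
open import Data.List using (List; []; _∷_)
open import Data.Nat using (ℕ; zero; suc; _≤_; z≤n; s≤s; _≟_)
open import Data.Nat.Properties using (1+n≢n)
open import Data.Product using (∃; _×_; _,_; proj₁; proj₂)
open import Function.Base using (_∘_; id)
open import Function.Bundles using (_⇔_)
open import Function.Definitions using (Injective)
open import Relation.Binary.Construct.Closure.Symmetric using (SymClosure; fwd; bwd; symmetric)
open import Relation.Binary.PropositionalEquality using (_≡_; _≢_; refl; sym; trans)
open import Relation.Nullary using (¬_; Dec; yes; no; contradiction; ¬?; _→-dec_; map′)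
open import Relation.Unary using (Decidable)

-- Simple graphs with decidable adjacency; a finite graph on n vertices is a
-- Graph (Fin n).
record Graph (V : Set) : Set₁ where
  field
    Adj    : V → V → Set
    adj?   : ∀ u v → Dec (Adj u v)
    adjSym : ∀ {u v} → Adj u v → Adj v u
    irrefl : ∀ {v} → ¬ Adj v v

open Graph public

ContainsInduced : {V W : Set} → Graph V → Graph W → Set
ContainsInduced {V} {W} G H =
  ∃ λ (φ : W → V) → Injective _≡_ _≡_ φ × (∀ u v → Adj H u v ⇔ Adj G (φ u) (φ v))

ContainsSubgraph : {V W : Set} → Graph V → Graph W → Set
ContainsSubgraph {V} {W} G H =
  ∃ λ (φ : W → V) → Injective _≡_ _≡_ φ × (∀ u v → Adj H u v → Adj G (φ u) (φ v))

infix 4 _isFreeOf_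

_isFreeOf_ : {V W : Set} → Graph V → Graph W → Set
G isFreeOf H = ¬ ContainsInduced G H

Proper : {V : Set} (G : Graph V) {k : ℕ} → (V → Fin k) → Set
Proper G c = ∀ u v → Adj G u v → c u ≢ c v

Colourable : {V : Set} → Graph V → ℕ → Set
Colourable {V} G k = ∃ λ (c : V → Fin k) → Proper G c

IsChromaticNumber : {V : Set} → Graph V → ℕ → Set
IsChromaticNumber G k = Colourable G k × (∀ j → Colourable G j → k ≤ j)

colourable? : ∀ {n} (G : Graph (Fin n)) → Decidable (Colourable G)
colourable? {n} G k = map′ fromCode toCode (any? proper?)
  where
  proper? : Decidable (λ i → Proper G (finToFun {k} {n} i))
  proper? i = all? λ u → all? λ v →
    adj? G u v →-dec ¬? (finToFun {k} {n} i u ≟ᶠ finToFun {k} {n} i v)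

  fromCode : (∃ λ i → Proper G (finToFun {k} {n} i)) → Colourable G k
  fromCode (i , proper) = finToFun i , proper

  toCode : Colourable G k → ∃ λ i → Proper G (finToFun {k} {n} i)
  toCode (c , proper) = funToFin c , λ u v uv eq →
    proper u v uv (trans (sym (finToFun-funToFin c u)) (trans eq (finToFun-funToFin c v)))

least : {P : ℕ → Set} → Decidable P → ∀ n → P n → ∃ λ m → P m × (∀ j → P j → m ≤ j)
least P? zero    pn = zero , pn , λ _ _ → z≤n
least {P} P? (suc n) pn with P? zero
... | yes p0 = zero , p0 , λ _ _ → z≤n
... | no ¬p0 with least (P? ∘ suc) n pn
...   | m , pm , minimal = suc m , pm , bound
  where
  bound : ∀ j → P j → suc m ≤ j
  bound zero    p0 = contradiction p0 ¬p0
  bound (suc j) pj = s≤s (minimal j pj)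

chromaticNumber : ∀ {n} (G : Graph (Fin n)) → ∃ (IsChromaticNumber G)
chromaticNumber {n} G =
  least (colourable? G) n (id , λ { u .u uu refl → irrefl G uu })

χ : ∀ {n} → Graph (Fin n) → ℕ
χ G = proj₁ (chromaticNumber G)

χ-isChromaticNumber : ∀ {n} (G : Graph (Fin n)) → IsChromaticNumber G (χ G)
χ-isChromaticNumber G = proj₂ (chromaticNumber G)

-- The simple graph whose edges are the pairs related by E in either direction.
fromEdges : {V : Set} (E : V → V → Set) →
            (∀ u v → Dec (E u v)) → (∀ {v} → ¬ E v v) → Graph V
fromEdges E E? E-irrefl = record
  { Adj    = SymClosure E
  ; adj?   = adjacent?
  ; adjSym = symmetric E
  ; irrefl = λ { (fwd e) → E-irrefl e ; (bwd e) → E-irrefl e }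
  }
  where
  adjacent? : ∀ u v → Dec (SymClosure E u v)
  adjacent? u v with E? u v | E? v u
  ... | yes e | _     = yes (fwd e)
  ... | no  _ | yes e = yes (bwd e)
  ... | no ¬e | no ¬f = no λ { (fwd e) → ¬e e ; (bwd f) → ¬f f }

data PawVertex : Set where
  q r s leaf : PawVertex

data PawEdge : PawVertex → PawVertex → Set where
  qr    : PawEdge q r
  rs    : PawEdge r s
  qs    : PawEdge q s
  qleaf : PawEdge q leaf

pawEdge? : ∀ u v → Dec (PawEdge u v)
pawEdge? q    q    = no λ ()
pawEdge? q    r    = yes qr
pawEdge? q    s    = yes qs
pawEdge? q    leaf = yes qleaf
pawEdge? r    q    = no λ ()
pawEdge? r    r    = no λ ()
pawEdge? r    s    = yes rs
pawEdge? r    leaf = no λ ()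
pawEdge? s    _    = no λ ()
pawEdge? leaf _    = no λ ()

paw : Graph PawVertex
paw = fromEdges PawEdge pawEdge? λ ()

-- The path vertex a_{i+1} is a i, so a_p is the a i with suc (toℕ i) ≡ p.
data TreeVertex (p : ℕ) : Set where
  a     : Fin p → TreeVertex p
  x y z : TreeVertex p

data TreeEdge (p : ℕ) : TreeVertex p → TreeVertex p → Set where
  path : ∀ {i j} → suc (toℕ i) ≡ toℕ j → TreeEdge p (a i) (a j)
  ax   : ∀ {i} → suc (toℕ i) ≡ p → TreeEdge p (a i) x
  ay   : ∀ {i} → suc (toℕ i) ≡ p → TreeEdge p (a i) y
  xz   : TreeEdge p x z

treeEdge? : ∀ p u v → Dec (TreeEdge p u v)
treeEdge? p (a i) (a j) = map′ path (λ { (path e) → e }) (suc (toℕ i) ≟ toℕ j)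
treeEdge? p (a i) x     = map′ ax (λ { (ax e) → e }) (suc (toℕ i) ≟ p)
treeEdge? p (a i) y     = map′ ay (λ { (ay e) → e }) (suc (toℕ i) ≟ p)
treeEdge? p (a i) z     = no λ ()
treeEdge? p x     (a _) = no λ ()
treeEdge? p x     x     = no λ ()
treeEdge? p x     y     = no λ ()
treeEdge? p x     z     = yes xz
treeEdge? p y     _     = no λ ()
treeEdge? p z     _     = no λ ()

T₁ : (p : ℕ) → Graph (TreeVertex p)
T₁ p = fromEdges (TreeEdge p) (treeEdge? p) λ { (path e) → 1+n≢n e }

K : (d t : ℕ) → Graph (Fin d × Fin t)
K d t = record
  { Adj    = λ u v → proj₁ u ≢ proj₁ v
  ; adj?   = λ u v → ¬? (proj₁ u ≟ᶠ proj₁ v)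
  ; adjSym = λ ne eq → ne (sym eq)
  ; irrefl = λ ne → ne refl
  }

-- Coefficient lists, constant term first.
Polynomial : Set
Polynomial = List ℤ

eval : Polynomial → ℤ → ℤ
eval []       t = 0ℤ
eval (c ∷ cs) t = c + t * eval cs t

{-# OPTIONS --safe #-}
module Submission where

-- In a paw-free graph a neighbour of a vertex lying in a triangle lies in a
-- triangle itself, so every component either is triangle-free or has all its
-- vertices in triangles.
--
-- In a component of the second kind non-adjacency is transitive (Olariu), so it
-- is complete multipartite, and having d * t parts would give K_{dt} ⊇ K_d(t).
--
-- A triangle-free component is coloured along a Gyárfás path.  Let b₀ be the end
-- of an induced path and C a set attached to b₀ and to no other path vertex.
-- The neighbours of b₀ in C are stable; give them a colour of their own, and
-- extend the path by one vertex into each component of the rest.  Once the path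
-- has p vertices, T₁-freeness forces all neighbours of b₀ in C to be twins in C,
-- so that the distance layers from b₀ are stable and C is bipartite.  This uses
-- at most p + 3 colours, independently of d and t.

open import Defs
open import Data.Bool using (if_then_else_)
open import Data.Fin using (Fin; zero; suc; toℕ; fromℕ<; combine)
open import Data.Fin.Properties using (any?; toℕ<n; toℕ-injective; fromℕ<-injective; combine-injective; combine-injectiveˡ) renaming (_≟_ to _≟ᶠ_)
open import Data.Fin.Subset using (Subset; _∈_; _∉_; _⊆_; _⊂_; _⊃_; _∪_; ⁅_⁆; ⊤)
open import Data.Fin.Subset.Induction using (Acc; acc; ⊂-wellFounded; ⊃-wellFounded)
open import Data.Fin.Subset.Properties using (_∈?_; nonempty?; ∈⊤; x∈⁅x⁆; x∈⁅y⁆⇒x≡y; p⊆p∪q; q⊆p∪q; x∈p∪q⁻)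
open import Data.Integer using (+_; +≤+) renaming (_≤_ to _≤ℤ_; _+_ to _+ℤ_; _*_ to _*ℤ_)
open import Data.Integer.Properties using (pos-*) renaming (*-zeroʳ to *ℤ-zeroʳ)
open import Data.List using ([]; _∷_)
open import Data.Nat using (ℕ; zero; suc; _+_; _*_; _∸_; _≤_; _<_; z≤n; s≤s; z<s; s<s)
open import Data.Nat.Properties using (≤-trans; <-cmp; <-irrefl; n<1+n; m<n⇒m<1+n; m≤n⇒m<n∨m≡n; m≤m+n; m≤n+m; +-suc; +-identityʳ; *-comm; +-cancelˡ-≡; +-cancelʳ-≡; m∸n+n≡m; suc-injective)
open import Data.Product using (Σ; ∃; _×_; _,_; proj₁; proj₂)
open import Data.Sum using (_⊎_; inj₁; inj₂; [_,_]; swap) renaming (map to map⊎)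
open import Data.Vec using (tabulate)
open import Data.Vec.Properties using (lookup⇒[]=; []=⇒lookup; lookup∘tabulate)
open import Function.Base using (_∘_; const)
open import Function.Bundles using (mk⇔)
open import Relation.Binary.Construct.Closure.ReflexiveTransitive using (Star; ε; _◅_; _◅◅_; reverse) renaming (map to mapStar)
open import Relation.Binary.Construct.Closure.Symmetric using (fwd; bwd; fold)
open import Relation.Binary.Definitions using (tri<; tri≈; tri>)
open import Relation.Binary.PropositionalEquality using (_≡_; _≢_; refl; sym; trans; cong; cong₂; subst; module ≡-Reasoning)
open import Relation.Nullary using (¬_; yes; no; does; contradiction; ¬?; _×-dec_)
open import Relation.Nullary.Decidable using (dec-true; decidable-stable)
open import Relation.Unary using (Pred; Decidable)
open import Level using (0ℓ)

-- Restricted subsets, merged colourings and shifted sequences.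

module _ {n : ℕ} {P : Pred (Fin n) 0ℓ} (C : Subset n) (P? : Decidable P) where

  restrict : Subset n
  restrict = tabulate λ u → does ((u ∈? C) ×-dec P? u)

  ∈-restrict⁺ : ∀ {u} → u ∈ C → P u → u ∈ restrict
  ∈-restrict⁺ {u} u∈C Pu = lookup⇒[]= u restrict
    (trans (lookup∘tabulate _ u) (dec-true ((u ∈? C) ×-dec P? u) (u∈C , Pu)))

  ∈-restrict⁻ : ∀ {u} → u ∈ restrict → u ∈ C × P u
  ∈-restrict⁻ {u} u∈ with u ∈? C | P? u | trans (sym (lookup∘tabulate _ u)) ([]=⇒lookup u∈)
  ... | yes u∈C | yes Pu | _  = u∈C , Pu
  ... | yes _   | no _   | ()
  ... | no _    | _      | ()

  restrict-⊂ : ∀ {u} → u ∈ C → ¬ P u → restrict ⊂ C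
  restrict-⊂ u∈C ¬Pu = (λ {_} → proj₁ ∘ ∈-restrict⁻) , _ , u∈C , ¬Pu ∘ proj₂ ∘ ∈-restrict⁻

merge : {V : Set} {P : Pred V 0ℓ} → Decidable P → (V → ℕ) → (V → ℕ) → V → ℕ
merge P? c c′ u = if does (P? u) then c u else c′ u

infixr 5 _◂_

-- Paths are total sequences of which only an initial segment is meaningful; prepending a vertex
-- shifts all indices, so the growing end is always index 0.
_◂_ : {V : Set} → V → (ℕ → V) → ℕ → V
(v ◂ b) zero    = v
(v ◂ b) (suc i) = b i

module _ {n : ℕ} (G : Graph (Fin n)) where

  private
    V : Set
    V = Fin n

    infix 4 _~_ _≁_

    _~_ _≁_ : V → V → Set
    u ~ v = Adj G u v
    u ≁ v = ¬ (u ~ v)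

    ~-sym : ∀ {u v} → u ~ v → v ~ u
    ~-sym = adjSym G

    ~⇒≢ : ∀ {u v} → u ~ v → u ≢ v
    ~⇒≢ uv refl = irrefl G uv

  -- Colourings of vertex subsets

  ProperOn : Subset n → (V → ℕ) → Set
  ProperOn C c = ∀ {u v} → u ∈ C → v ∈ C → u ~ v → c u ≢ c v

  ColourableOn : Subset n → ℕ → Set
  ColourableOn C k = ∃ λ (c : V → ℕ) → (∀ {u} → u ∈ C → c u < k) × ProperOn C c

  colourableOn-mono : ∀ {C k l} → k ≤ l → ColourableOn C k → ColourableOn C l
  colourableOn-mono k≤l (c , bound , proper) = c , (λ u∈ → ≤-trans (bound u∈) k≤l) , proper

  colourableOn-empty : ∀ {C} k → (∀ u → u ∉ C) → ColourableOn C k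
  colourableOn-empty k empty =
    const 0 , (λ u∈ → contradiction u∈ (empty _)) , λ u∈ → contradiction u∈ (empty _)

  colourableOn-⊤ : ∀ {k} → ColourableOn ⊤ k → Colourable G k
  colourableOn-⊤ (c , bound , proper) =
    (λ u → fromℕ< (bound {u} ∈⊤)) ,
    λ u v uv eq → proper ∈⊤ ∈⊤ uv (fromℕ<-injective _ _ (bound ∈⊤) (bound ∈⊤) eq)

  merge-proper : ∀ {C c c′} {P : Pred V 0ℓ} (P? : Decidable P) →
    (∀ {u v} → u ∈ C → P u → v ∈ C → P v → u ~ v → c u ≢ c v) →
    ProperOn (restrict C (¬? ∘ P?)) c′ →
    (∀ {u v} → u ∈ C → P u → v ∈ C → ¬ P v → u ~ v → c u ≢ c′ v) →
    ProperOn C (merge P? c c′)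
  merge-proper {C} P? in-P off-P cross {u} {v} u∈ v∈ uv with P? u | P? v
  ... | yes Pu | yes Pv = in-P u∈ Pu v∈ Pv uv
  ... | yes Pu | no ¬Pv = cross u∈ Pu v∈ ¬Pv uv
  ... | no ¬Pu | yes Pv = cross v∈ Pv u∈ ¬Pu (~-sym uv) ∘ sym
  ... | no ¬Pu | no ¬Pv =
    off-P (∈-restrict⁺ C (¬? ∘ P?) u∈ ¬Pu) (∈-restrict⁺ C (¬? ∘ P?) v∈ ¬Pv) uv

  merge-satisfies : ∀ {C c c′} {P : Pred V 0ℓ} (P? : Decidable P) {Q : Pred ℕ 0ℓ} →
    (∀ {u} → u ∈ C → P u → Q (c u)) →
    (∀ {u} → u ∈ restrict C (¬? ∘ P?) → Q (c′ u)) →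
    ∀ {u} → u ∈ C → Q (merge P? c c′ u)
  merge-satisfies {C} P? in-P off-P {u} u∈ with P? u
  ... | yes Pu = in-P u∈ Pu
  ... | no ¬Pu = off-P (∈-restrict⁺ C (¬? ∘ P?) u∈ ¬Pu)

  -- The colour `k` is fresh, since the colouring of the remaining vertices stays below `k`.
  colour-stable : ∀ {C k} {P : Pred V 0ℓ} (P? : Decidable P) →
    (∀ {u v} → u ∈ C → P u → v ∈ C → P v → u ≁ v) →
    ColourableOn (restrict C (¬? ∘ P?)) k → ColourableOn C (suc k)
  colour-stable {C} {k} P? stable (c , bound , proper) =
    merge P? (const k) c ,
    merge-satisfies {C} P? {Q = _< suc k} (λ _ _ → n<1+n k) (m<n⇒m<1+n ∘ bound) ,
    merge-proper {C} P? (λ u∈ Pu v∈ Pv uv → contradiction uv (stable u∈ Pu v∈ Pv)) proper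
      λ _ _ v∈ ¬Pv _ eq → <-irrefl (sym eq) (bound (∈-restrict⁺ C (¬? ∘ P?) v∈ ¬Pv))

  -- Components

  StepIn : Subset n → V → V → Set
  StepIn A u v = u ~ v × u ∈ A × v ∈ A

  WalkIn : Subset n → V → V → Set
  WalkIn A = Star (StepIn A)

  walk-sym : ∀ {A u v} → WalkIn A u v → WalkIn A v u
  walk-sym = reverse λ { (uv , u∈ , v∈) → ~-sym uv , v∈ , u∈ }

  -- The walks in `connected` stay inside `A` itself, so they remain usable once the ambient set is
  -- forgotten; `closed` gives maximality within `S`.
  record Component (S : Subset n) (v : V) (A : Subset n) : Set where
    field
      ⊆-ambient : A ⊆ S
      root∈     : v ∈ A
      connected : ∀ {u} → u ∈ A → WalkIn A v u
      closed    : ∀ {u w} → u ∈ A → w ∈ S → u ~ w → w ∈ A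

  open Component

  -- Starting from the single root, vertices of `S` with a neighbour in the current set are added
  -- one at a time until none is left.
  component : ∀ S {v} → v ∈ S → ∃ (Component S v)
  component S {v} v∈S = grow ⁅ v ⁆ (⊃-wellFounded _)
    (λ u∈ → subst (_∈ S) (sym (x∈⁅y⁆⇒x≡y v u∈)) v∈S) (x∈⁅x⁆ v)
    λ u∈ → subst (WalkIn ⁅ v ⁆ v) (sym (x∈⁅y⁆⇒x≡y v u∈)) ε
    where
    grow : ∀ A → Acc _⊃_ A → A ⊆ S → v ∈ A → (∀ {u} → u ∈ A → WalkIn A v u) →
           ∃ (Component S v)
    grow A (acc larger) A⊆S v∈A conn
      with any? (λ w → (w ∈? S) ×-dec (¬? (w ∈? A) ×-dec any? (λ u → (u ∈? A) ×-dec adj? G u w)))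
    ... | no none = A , record
      { ⊆-ambient = A⊆S
      ; root∈     = v∈A
      ; connected = conn
      ; closed    = λ u∈ w∈S uw → decidable-stable (_ ∈? A) λ w∉A →
                      none (_ , w∈S , w∉A , _ , u∈ , uw)
      }
    ... | yes (w , w∈S , w∉A , u , u∈A , uw) =
      grow A′ (larger ((λ {_} → A⊆A′) , w , w∈A′ , w∉A))
        (λ t∈ → [ A⊆S , (λ t∈w → subst (_∈ S) (sym (x∈⁅y⁆⇒x≡y w t∈w)) w∈S) ] (x∈p∪q⁻ A ⁅ w ⁆ t∈))
        (A⊆A′ v∈A)
        λ t∈ → [ walk , (λ t∈w → subst (WalkIn A′ v) (sym (x∈⁅y⁆⇒x≡y w t∈w))
                           (walk u∈A ◅◅ (uw , A⊆A′ u∈A , w∈A′) ◅ ε)) ] (x∈p∪q⁻ A ⁅ w ⁆ t∈)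
      where
      A′ : Subset n
      A′ = A ∪ ⁅ w ⁆

      A⊆A′ : A ⊆ A′
      A⊆A′ = p⊆p∪q ⁅ w ⁆

      w∈A′ : w ∈ A′
      w∈A′ = q⊆p∪q A ⁅ w ⁆ (x∈⁅x⁆ w)

      walk : ∀ {t} → t ∈ A → WalkIn A′ v t
      walk t∈ = mapStar (λ { (e , i , j) → e , A⊆A′ i , A⊆A′ j }) (conn t∈)

  -- An edge from `B` to the deleted component `A` would, by closedness of `A`, put its end in `B`
  -- into `A` as well; so `B` is already closed in `S`.
  component-outside : ∀ {S v A u B} → Component S v A →
    Component (restrict S (¬? ∘ (_∈? A))) u B → Component S u B
  component-outside {S} {A = A} comp comp′ = record
    { ⊆-ambient = rest⊆S ∘ ⊆-ambient comp′
    ; root∈     = root∈ comp′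
    ; connected = connected comp′
    ; closed    = λ u∈ w∈S uw → closed comp′ u∈
        (∈-restrict⁺ S (¬? ∘ (_∈? A)) w∈S λ w∈A →
          proj₂ (∈-restrict⁻ S (¬? ∘ (_∈? A)) (⊆-ambient comp′ u∈))
            (closed comp w∈A (rest⊆S (⊆-ambient comp′ u∈)) (~-sym uw)))
        uw
    }
    where
    rest⊆S : restrict S (¬? ∘ (_∈? A)) ⊆ S
    rest⊆S = proj₁ ∘ ∈-restrict⁻ S (¬? ∘ (_∈? A))

  -- No edge leaves a component, so both sides can share one palette.
  colour-component-and-rest : ∀ {S k v A} → Component S v A →
    ColourableOn A k → ColourableOn (restrict S (¬? ∘ (_∈? A))) k → ColourableOn S k
  colour-component-and-rest {S} {k} {A = A} comp (c , bound , proper) (c′ , bound′ , proper′) =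
    merge (_∈? A) c c′ ,
    merge-satisfies {S} (_∈? A) {Q = _< k} (λ _ → bound) bound′ ,
    merge-proper {S} (_∈? A) (λ _ u∈ _ v∈ → proper u∈ v∈) proper′
      λ _ u∈A w∈S w∉A uw → contradiction (closed comp u∈A w∈S uw) w∉A

  colour-components : ∀ S k → (∀ {v A} → Component S v A → ColourableOn A k) →
    ColourableOn S k
  colour-components S k = go S (⊂-wellFounded S)
    where
    go : ∀ S → Acc _⊂_ S → (∀ {v A} → Component S v A → ColourableOn A k) → ColourableOn S k
    go S (acc smaller) colourable with nonempty? S
    ... | no empty = colourableOn-empty k λ u u∈ → empty (u , u∈)
    ... | yes (v , v∈S) with component S v∈S
    ...   | A , comp = colour-component-and-rest comp (colourable comp)
      (go (restrict S (¬? ∘ (_∈? A)))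
        (smaller (restrict-⊂ S (¬? ∘ (_∈? A)) v∈S λ v∉A → v∉A (root∈ comp)))
        (colourable ∘ component-outside comp))

  -- Complete multipartite sets

  CliqueIn : Subset n → ℕ → Set
  CliqueIn S m = ∃ λ (φ : Fin m → V) →
    (∀ i → φ i ∈ S) × (∀ i j → i ≢ j → φ i ~ φ j)

  -- Peel off the part of some vertex `v`, namely its non-neighbours including `v`. Every remaining
  -- vertex is adjacent to `v`, so a clique found among them extends by `v`, while a colouring of
  -- them extends by one colour for the part.
  multipartite-colourable-or-clique : ∀ m S →
    (∀ {u v w} → u ∈ S → v ∈ S → w ∈ S → u ≁ v → v ≁ w → u ≁ w) →
    ColourableOn S m ⊎ CliqueIn S m
  multipartite-colourable-or-clique zero S ≁-trans = inj₂ ((λ ()) , (λ ()) , λ ())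
  multipartite-colourable-or-clique (suc m) S ≁-trans with nonempty? S
  ... | no empty = inj₁ (colourableOn-empty (suc m) λ u u∈ → empty (u , u∈))
  ... | yes (v , v∈S) = map⊎ addColour addVertex
    (multipartite-colourable-or-clique m S′ λ u∈ w∈ t∈ → ≁-trans (S′⊆S u∈) (S′⊆S w∈) (S′⊆S t∈))
    where
    Far? : Decidable (v ≁_)
    Far? u = ¬? (adj? G v u)

    S′ : Subset n
    S′ = restrict S (¬? ∘ Far?)

    S′⊆S : S′ ⊆ S
    S′⊆S = proj₁ ∘ ∈-restrict⁻ S (¬? ∘ Far?)

    addColour : ColourableOn S′ m → ColourableOn S (suc m)
    addColour = colour-stable Far? λ u∈ v≁u w∈ v≁w → ≁-trans u∈ v∈S w∈ (v≁u ∘ ~-sym) v≁w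

    addVertex : CliqueIn S′ m → CliqueIn S (suc m)
    addVertex (φ , φ∈ , clique) = φ′ , φ′∈ , clique′
      where
      φ′ : Fin (suc m) → V
      φ′ zero    = v
      φ′ (suc i) = φ i

      φ′∈ : ∀ i → φ′ i ∈ S
      φ′∈ zero    = v∈S
      φ′∈ (suc i) = S′⊆S (φ∈ i)

      v~φ : ∀ i → v ~ φ i
      v~φ i = decidable-stable (adj? G v (φ i)) (proj₂ (∈-restrict⁻ S (¬? ∘ Far?) (φ∈ i)))

      clique′ : ∀ i j → i ≢ j → φ′ i ~ φ′ j
      clique′ zero    zero    i≢j = contradiction refl i≢j
      clique′ zero    (suc j) i≢j = v~φ j
      clique′ (suc i) zero    i≢j = ~-sym (v~φ i)
      clique′ (suc i) (suc j) i≢j = clique i j (i≢j ∘ cong suc)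

  clique⇒K : ∀ {S d t} → CliqueIn S (d * t) → ContainsSubgraph G (K d t)
  clique⇒K (φ , φ∈ , clique) =
    (λ { (i , j) → φ (combine i j) }) ,
    (λ { {i , j} {k , l} eq → injective i j k l eq }) ,
    λ { (i , j) (k , l) i≢k → clique _ _ (i≢k ∘ combine-injectiveˡ i j k l) }
    where
    injective : ∀ i j k l → φ (combine i j) ≡ φ (combine k l) → (i , j) ≡ (k , l)
    injective i j k l eq with combine i j ≟ᶠ combine k l
    ... | yes same = let i≡k , j≡l = combine-injective i j k l same in cong₂ _,_ i≡k j≡l
    ... | no differ = contradiction eq (~⇒≢ (clique _ _ differ))

  -- Triangles in paw-free graphs

  InTriangle : V → Set
  InTriangle u = ∃ λ v → ∃ λ w → u ~ v × v ~ w × u ~ w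

  inTriangle? : Decidable InTriangle
  inTriangle? u = any? λ v → any? λ w → adj? G u v ×-dec (adj? G v w ×-dec adj? G u w)

  module _ (paw-free : G isFreeOf paw) where

    -- Otherwise the triangle `u`, `v`, `w` and the vertex `l` induce a paw with `u` as its vertex
    -- of degree three.
    no-pendant : ∀ {u v w l} → u ~ v → v ~ w → u ~ w → u ~ l → v ~ l ⊎ w ~ l
    no-pendant {u} {v} {w} {l} uv vw uw ul with adj? G v l | adj? G w l
    ... | yes vl | _      = inj₁ vl
    ... | no _   | yes wl = inj₂ wl
    ... | no v≁l | no w≁l = contradiction
      (φ , (λ {_} {_} → injective) , λ i j → mk⇔ (fold ~-sym edge) (reflects i j)) paw-free
      where
      φ : PawVertex → V
      φ q    = u
      φ r    = v
      φ s    = w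
      φ leaf = l

      edge : ∀ {i j} → PawEdge i j → φ i ~ φ j
      edge qr    = uv
      edge rs    = vw
      edge qs    = uw
      edge qleaf = ul

      reflects : ∀ i j → φ i ~ φ j → Adj paw i j
      reflects q    q    e = contradiction e (irrefl G)
      reflects q    r    e = fwd qr
      reflects q    s    e = fwd qs
      reflects q    leaf e = fwd qleaf
      reflects r    q    e = bwd qr
      reflects r    r    e = contradiction e (irrefl G)
      reflects r    s    e = fwd rs
      reflects r    leaf e = contradiction e v≁l
      reflects s    q    e = bwd qs
      reflects s    r    e = bwd rs
      reflects s    s    e = contradiction e (irrefl G)
      reflects s    leaf e = contradiction e w≁l
      reflects leaf q    e = bwd qleaf
      reflects leaf r    e = contradiction (~-sym e) v≁l
      reflects leaf s    e = contradiction (~-sym e) w≁l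
      reflects leaf leaf e = contradiction e (irrefl G)

      v≢l : v ≢ l
      v≢l refl = w≁l (~-sym vw)

      w≢l : w ≢ l
      w≢l refl = v≁l vw

      injective : ∀ {i j} → φ i ≡ φ j → i ≡ j
      injective {q}    {q}    e = refl
      injective {q}    {r}    e = contradiction e (~⇒≢ uv)
      injective {q}    {s}    e = contradiction e (~⇒≢ uw)
      injective {q}    {leaf} e = contradiction e (~⇒≢ ul)
      injective {r}    {q}    e = contradiction (sym e) (~⇒≢ uv)
      injective {r}    {r}    e = refl
      injective {r}    {s}    e = contradiction e (~⇒≢ vw)
      injective {r}    {leaf} e = contradiction e v≢l
      injective {s}    {q}    e = contradiction (sym e) (~⇒≢ uw)
      injective {s}    {r}    e = contradiction (sym e) (~⇒≢ vw)
      injective {s}    {s}    e = refl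
      injective {s}    {leaf} e = contradiction e w≢l
      injective {leaf} {q}    e = contradiction (sym e) (~⇒≢ ul)
      injective {leaf} {r}    e = contradiction (sym e) v≢l
      injective {leaf} {s}    e = contradiction (sym e) w≢l
      injective {leaf} {leaf} e = refl

    edge-in-triangle : ∀ {u v} → InTriangle u → u ~ v → ∃ λ w → u ~ w × v ~ w
    edge-in-triangle (w , t , uw , wt , ut) uv with no-pendant uw wt ut uv
    ... | inj₁ wv = w , uw , ~-sym wv
    ... | inj₂ tv = t , ut , ~-sym tv

    inTriangle-~ : ∀ {u v} → InTriangle u → u ~ v → InTriangle v
    inTriangle-~ tri uv with edge-in-triangle tri uv
    ... | w , uw , vw = _ , w , ~-sym uv , uw , vw

    inTriangle-walk : ∀ {A u v} → InTriangle u → WalkIn A u v → InTriangle v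
    inTriangle-walk tri ε              = tri
    inTriangle-walk tri ((e , _) ◅ es) = inTriangle-walk (inTriangle-~ tri e) es

    -- If `v` is adjacent to `w`, apply `no-pendant` to the triangle `v`, `u`, `w`. Otherwise take a
    -- triangle `u`, `v`, `t`: seen from `u` it forces `t ~ w`, seen from `v` it forces `t ~ v′`
    -- (unless `u ~ v′`), and the triangle `t`, `u`, `w` then has `v′` as a further neighbour of
    -- `t`.
    edge-dominates-step : ∀ {u w v v′} → InTriangle u → u ~ w → v ~ u → v ~ v′ →
      v′ ~ u ⊎ v′ ~ w
    edge-dominates-step {u} {w} {v} {v′} tri uw vu vv′ with adj? G v w | adj? G v′ u
    ... | _      | yes v′u = inj₁ v′u
    ... | yes vw | no _    = map⊎ ~-sym ~-sym (no-pendant vu uw vw vv′)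
    ... | no v≁w | no v′≁u with edge-in-triangle tri (~-sym vu)
    ...   | t , ut , vt with no-pendant (~-sym vu) vt ut uw | no-pendant vu ut vt vv′
    ...     | inj₁ vw | _        = contradiction vw v≁w
    ...     | inj₂ _  | inj₁ uv′ = inj₁ (~-sym uv′)
    ...     | inj₂ tw | inj₂ tv′ =
      map⊎ ~-sym ~-sym (no-pendant (~-sym ut) uw tw tv′)

    edge-dominates : ∀ {A u w v} → InTriangle u → u ~ w → WalkIn A u v →
      v ~ u ⊎ v ~ w
    edge-dominates {A} {u} {w} tri uw = along (inj₂ uw)
      where
      along : ∀ {v v′} → v ~ u ⊎ v ~ w → WalkIn A v v′ → v′ ~ u ⊎ v′ ~ w
      along near ε = near
      along (inj₁ vu) ((e , _) ◅ es) = along (edge-dominates-step tri uw vu e) es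
      -- The ends of the edge exchange roles; `w` lies in a triangle because `u` does.
      along (inj₂ vw) ((e , _) ◅ es) =
        along (swap (edge-dominates-step (inTriangle-~ tri uw) (~-sym uw) vw e)) es

    -- If `u` and `t` were adjacent, that edge would dominate the component, yet `w` is adjacent to
    -- neither end.
    component-with-triangle : ∀ {S v A} → Component S v A → InTriangle v →
      ∀ {u w t} → u ∈ A → w ∈ A → t ∈ A → u ≁ w → w ≁ t → u ≁ t
    component-with-triangle comp tri u∈ w∈ t∈ u≁w w≁t ut
      with edge-dominates (inTriangle-walk tri (connected comp u∈)) ut
             (walk-sym (connected comp u∈) ◅◅ connected comp w∈)
    ... | inj₁ wu = u≁w (~-sym wu)
    ... | inj₂ wt = w≁t wt

  -- Gyárfás paths

  -- A walk from `v` to the index vertex whose intermediate vertices lie in `C`; neither end is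
  -- required to lie in `C`.
  data Attached (C : Subset n) (v : V) : V → Set where
    near : ∀ {w} → v ~ w → Attached C v w
    far  : ∀ {u w} → Attached C v u → u ∈ C → u ~ w → Attached C v w

  attached-walk : ∀ {C v u w} → Attached C v u → WalkIn C u w → Attached C v w
  attached-walk att ε                   = att
  attached-walk att ((e , u∈ , _) ◅ es) = attached-walk (far att u∈ e) es

  -- The induced path is b (k - 1), ..., b 0; it grows at b 0.
  record Gyárfás (k : ℕ) (b : ℕ → V) (C : Subset n) : Set where
    field
      distinct     : ∀ {i j} → i < j → j < k → b i ≢ b j
      consecutive  : ∀ {i} → suc i < k → b i ~ b (suc i)
      chordless    : ∀ {i j} → suc i < j → j < k → b i ≁ b j
      outside      : ∀ {w i} → w ∈ C → i < k → w ≢ b i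
      anticomplete : ∀ {w i} → w ∈ C → suc i < k → w ≁ b (suc i)
      attached     : ∀ {w} → w ∈ C → Attached C (b 0) w
      no-triangle  : ∀ {w} → w ∈ C → ¬ InTriangle w

  open Gyárfás

  -- The new end `v` comes from `C`, so its only neighbour on the old path is `b 0`. Since `D`
  -- avoids the neighbours of `b 0`, the old end joins the vertices without neighbours in the
  -- remaining set.
  extend : ∀ {k b C v D} → Gyárfás k b C → v ∈ C → b 0 ~ v →
    (∀ {w} → w ∈ D → w ∈ C × b 0 ≁ w) → (∀ {w} → w ∈ D → Attached D v w) →
    Gyárfás (suc k) (v ◂ b) D
  extend {k} {b} {C} {v} {D} gy v∈C bv inside att = record
    { distinct     = dist
    ; consecutive  = cons
    ; chordless    = chord
    ; outside      = out
    ; anticomplete = anti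
    ; attached     = att
    ; no-triangle  = no-triangle gy ∘ proj₁ ∘ inside
    }
    where
    dist : ∀ {i j} → i < j → j < suc k → (v ◂ b) i ≢ (v ◂ b) j
    dist {zero}  {suc j} _         (s<s j<k) = outside gy v∈C j<k
    dist {suc i} {suc j} (s<s i<j) (s<s j<k) = distinct gy i<j j<k

    cons : ∀ {i} → suc i < suc k → (v ◂ b) i ~ b i
    cons {zero}  _       = ~-sym bv
    cons {suc i} (s<s l) = consecutive gy l

    chord : ∀ {i j} → suc i < j → j < suc k → (v ◂ b) i ≁ (v ◂ b) j
    chord {zero}  {suc (suc j)} _         (s<s j<k) = anticomplete gy v∈C j<k
    chord {suc i} {suc j}       (s<s i<j) (s<s j<k) = chordless gy i<j j<k
    chord {zero}  {suc zero}    (s<s ())  _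

    out : ∀ {w i} → w ∈ D → i < suc k → w ≢ (v ◂ b) i
    out {i = zero}  w∈ _       refl = proj₂ (inside w∈) bv
    out {i = suc i} w∈ (s<s l)      = outside gy (proj₁ (inside w∈)) l

    anti : ∀ {w i} → w ∈ D → suc i < suc k → w ≁ b i
    anti {i = zero}  w∈ _       = proj₂ (inside w∈) ∘ ~-sym
    anti {i = suc i} w∈ (s<s l) = anticomplete gy (proj₁ (inside w∈)) l

  neighbours-stable : ∀ {k b C u v} → Gyárfás k b C → u ∈ C → b 0 ~ u → b 0 ~ v → u ≁ v
  neighbours-stable gy u∈ bu bv uv = no-triangle gy u∈ (_ , _ , ~-sym bu , bv , uv)

  -- Copies of `T₁` at the end of a long path.

  module _ {p : ℕ} where

    private
      -- The tree branches at its last path vertex and the Gyárfás path grows at `b 0`, so indices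
      -- are reversed; a longer path contributes just its `p` vertices nearest to `b 0`.
      fromEnd : Fin p → ℕ
      fromEnd i = p ∸ suc (toℕ i)

      -- This identity replaces truncated subtraction in the index computations that follow.
      fromEnd-+ : ∀ i → fromEnd i + suc (toℕ i) ≡ p
      fromEnd-+ i = m∸n+n≡m (toℕ<n i)

      fromEnd< : ∀ i → fromEnd i < p
      fromEnd< i = subst (fromEnd i <_) (fromEnd-+ i)
        (subst (suc (fromEnd i) ≤_) (sym (+-suc (fromEnd i) (toℕ i))) (s≤s (m≤m+n (fromEnd i) (toℕ i))))

      fromEnd-suc : ∀ i j → suc (toℕ i) ≡ toℕ j → fromEnd i ≡ suc (fromEnd j)
      fromEnd-suc i j eq = +-cancelʳ-≡ (suc (toℕ i)) _ _
        (trans (fromEnd-+ i) (trans (sym (fromEnd-+ j))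
          (trans (cong (λ m → fromEnd j + suc m) (sym eq)) (+-suc (fromEnd j) (suc (toℕ i))))))

      fromEnd-suc⁻ : ∀ i j → fromEnd i ≡ suc (fromEnd j) → suc (toℕ i) ≡ toℕ j
      fromEnd-suc⁻ i j eq = suc-injective (+-cancelˡ-≡ (fromEnd j) _ _
        (trans (+-suc (fromEnd j) (suc (toℕ i)))
          (trans (cong (_+ suc (toℕ i)) (sym eq)) (trans (fromEnd-+ i) (sym (fromEnd-+ j))))))

      fromEnd-last : ∀ i → suc (toℕ i) ≡ p → fromEnd i ≡ 0
      fromEnd-last i eq = +-cancelʳ-≡ (suc (toℕ i)) _ _ (trans (fromEnd-+ i) (sym eq))

      fromEnd-last⁻ : ∀ i → fromEnd i ≡ 0 → suc (toℕ i) ≡ p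
      fromEnd-last⁻ i eq = trans (cong (_+ suc (toℕ i)) (sym eq)) (fromEnd-+ i)

      fromEnd-injective : ∀ i j → fromEnd i ≡ fromEnd j → i ≡ j
      fromEnd-injective i j eq = toℕ-injective (suc-injective (+-cancelˡ-≡ (fromEnd i) _ _
        (trans (fromEnd-+ i) (trans (sym (fromEnd-+ j)) (cong (_+ suc (toℕ j)) (sym eq))))))

    -- The path supplies the `a i`, while `u`, `v`, `w` serve as `x`, `y`, `z`. Absence of triangles
    -- excludes the edges `uv` and `b 0`-`w`, and `C` meets the path's neighbourhoods only at `b 0`.
    distinguished-neighbours⇒T₁ : ∀ {k b C u v w} → Gyárfás k b C → p ≤ k →
      u ∈ C → b 0 ~ u → v ∈ C → b 0 ~ v → w ∈ C → u ~ w → v ≁ w →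
      ContainsInduced G (T₁ p)
    distinguished-neighbours⇒T₁ {k} {b} {C} {u} {v} {w} gy p≤k u∈ bu v∈ bv w∈ uw v≁w =
      φ , (λ {_} {_} → injective) , λ i j → mk⇔ (fold ~-sym edge) (reflects i j)
      where
      φ : TreeVertex p → V
      φ (a i) = b (fromEnd i)
      φ x     = u
      φ y     = v
      φ z     = w

      <k : ∀ i → fromEnd i < k
      <k i = ≤-trans (fromEnd< i) p≤k

      b≁w : b 0 ≁ w
      b≁w bw = neighbours-stable gy u∈ bu bw uw

      u≁v : u ≁ v
      u≁v = neighbours-stable gy u∈ bu bv

      u≢v : u ≢ v
      u≢v refl = v≁w uw

      v≢w : v ≢ w
      v≢w refl = b≁w bv

      edge : ∀ {i j} → TreeEdge p i j → φ i ~ φ j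
      edge (path {i} {j} eq) = subst (λ m → b m ~ b (fromEnd j)) (sym (fromEnd-suc i j eq))
        (~-sym (consecutive gy (subst (_< k) (fromEnd-suc i j eq) (<k i))))
      edge (ax {i} eq) = subst (λ m → b m ~ u) (sym (fromEnd-last i eq)) bu
      edge (ay {i} eq) = subst (λ m → b m ~ v) (sym (fromEnd-last i eq)) bv
      edge xz = uw

      attached-at-end : ∀ i {t} → t ∈ C → b (fromEnd i) ~ t → fromEnd i ≡ 0 × b 0 ~ t
      attached-at-end i t∈ e with fromEnd i | <k i
      ... | zero  | _ = refl , e
      ... | suc m | l = contradiction (~-sym e) (anticomplete gy t∈ l)

      path-edge : ∀ i j → fromEnd i < fromEnd j → φ (a i) ~ φ (a j) → TreeEdge p (a j) (a i)
      path-edge i j i<j e with m≤n⇒m<n∨m≡n i<j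
      ... | inj₁ gap = contradiction e (chordless gy gap (<k j))
      ... | inj₂ eq  = path (fromEnd-suc⁻ j i (sym eq))

      reflects : ∀ i j → φ i ~ φ j → Adj (T₁ p) i j
      reflects (a i) (a j) e with <-cmp (fromEnd i) (fromEnd j)
      ... | tri< i<j _ _ = bwd (path-edge i j i<j e)
      ... | tri> _ _ j<i = fwd (path-edge j i j<i (~-sym e))
      ... | tri≈ _ eq _  = contradiction (cong b eq) (~⇒≢ e)
      reflects (a i) x e = fwd (ax (fromEnd-last⁻ i (proj₁ (attached-at-end i u∈ e))))
      reflects (a i) y e = fwd (ay (fromEnd-last⁻ i (proj₁ (attached-at-end i v∈ e))))
      reflects (a i) z e = contradiction (proj₂ (attached-at-end i w∈ e)) b≁w
      reflects x (a i) e = bwd (ax (fromEnd-last⁻ i (proj₁ (attached-at-end i u∈ (~-sym e)))))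
      reflects y (a i) e = bwd (ay (fromEnd-last⁻ i (proj₁ (attached-at-end i v∈ (~-sym e)))))
      reflects z (a i) e = contradiction (proj₂ (attached-at-end i w∈ (~-sym e))) b≁w
      reflects x x e = contradiction e (irrefl G)
      reflects x y e = contradiction e u≁v
      reflects x z e = fwd xz
      reflects y x e = contradiction (~-sym e) u≁v
      reflects y y e = contradiction e (irrefl G)
      reflects y z e = contradiction e v≁w
      reflects z x e = bwd xz
      reflects z y e = contradiction (~-sym e) v≁w
      reflects z z e = contradiction e (irrefl G)

      injective : ∀ {i j} → φ i ≡ φ j → i ≡ j
      injective {a i} {a j} e with <-cmp (fromEnd i) (fromEnd j)
      ... | tri< i<j _ _ = contradiction e (distinct gy i<j (<k j))
      ... | tri> _ _ j<i = contradiction (sym e) (distinct gy j<i (<k i))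
      ... | tri≈ _ eq _  = cong a (fromEnd-injective i j eq)
      injective {a i} {x} e = contradiction (sym e) (outside gy u∈ (<k i))
      injective {a i} {y} e = contradiction (sym e) (outside gy v∈ (<k i))
      injective {a i} {z} e = contradiction (sym e) (outside gy w∈ (<k i))
      injective {x} {a i} e = contradiction e (outside gy u∈ (<k i))
      injective {y} {a i} e = contradiction e (outside gy v∈ (<k i))
      injective {z} {a i} e = contradiction e (outside gy w∈ (<k i))
      injective {x} {x} e = refl
      injective {x} {y} e = contradiction e u≢v
      injective {x} {z} e = contradiction e (~⇒≢ uw)
      injective {y} {x} e = contradiction (sym e) u≢v
      injective {y} {y} e = refl
      injective {y} {z} e = contradiction e v≢w
      injective {z} {x} e = contradiction (sym e) (~⇒≢ uw)
      injective {z} {y} e = contradiction (sym e) v≢w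
      injective {z} {z} e = refl

    -- Colouring triangle-free components.

    module _ (T₁-free : G isFreeOf T₁ p) where

      neighbours-twins : ∀ {k b C u v w} → Gyárfás k b C → p ≤ k →
        u ∈ C → b 0 ~ u → v ∈ C → b 0 ~ v → w ∈ C → u ~ w → v ~ w
      neighbours-twins gy p≤k u∈ bu v∈ bv w∈ uw = decidable-stable (adj? G _ _) λ v≁w →
        T₁-free (distinguished-neighbours⇒T₁ gy p≤k u∈ bu v∈ bv w∈ uw v≁w)

      -- Fixing the colour of the neighbours of `v` is what allows consecutive distance layers to be
      -- glued.
      TwoColouring : V → Subset n → ℕ → ℕ → Set
      TwoColouring v C i j = ∃ λ (c : V → ℕ) →
        (∀ {u} → u ∈ C → c u ≡ i ⊎ c u ≡ j) × ProperOn C c × (∀ {u} → u ∈ C → v ~ u → c u ≡ i)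

      -- The roles of the two colours swap from one distance layer to the next.
      bipartite : ∀ {k b} C → Acc _⊂_ C → Gyárfás k b C → p ≤ k → ∀ i j → i ≢ j →
        TwoColouring (b 0) C i j
      bipartite {k} {b} C (acc smaller) gy p≤k i j i≢j
        with any? (λ u → (u ∈? C) ×-dec adj? G (b 0) u)
      -- Attachment starts with a neighbour of `b 0` in `C`, so here `C` is empty and any colouring
      -- will do.
      ... | no none =
        const i , (λ _ → inj₁ refl) ,
        (λ u∈ → contradiction (first u∈ (attached gy u∈)) none) , λ _ _ → refl
        where
        first : ∀ {w} → w ∈ C → Attached C (b 0) w → ∃ λ u → u ∈ C × b 0 ~ u
        first w∈ (near bw)      = _ , w∈ , bw
        first w∈ (far att u∈ _) = first u∈ att
      ... | yes (v , v∈ , bv) = result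
        where
        Near? : Decidable (b 0 ~_)
        Near? = adj? G (b 0)

        D : Subset n
        D = restrict C (¬? ∘ Near?)

        D⁻ : ∀ {w} → w ∈ D → w ∈ C × b 0 ≁ w
        D⁻ = ∈-restrict⁻ C (¬? ∘ Near?)

        -- Follow the attachment back to the last neighbour of `b 0` on it: `v` is its twin in `C`
        -- and can replace it, so one vertex stands for the whole first layer.
        reattach : ∀ {w} → w ∈ C → b 0 ≁ w → Attached C (b 0) w → Attached D v w
        reattach w∈ b≁w (near bw) = contradiction bw b≁w
        reattach w∈ b≁w (far {u} att u∈ uw) with Near? u
        ... | yes bu = near (neighbours-twins gy p≤k u∈ bu v∈ bv w∈ uw)
        ... | no b≁u = far (reattach u∈ b≁u att) (∈-restrict⁺ C (¬? ∘ Near?) u∈ b≁u) uw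

        gy′ : Gyárfás (suc k) (v ◂ b) D
        gy′ = extend gy v∈ bv D⁻ λ w∈ →
          reattach (proj₁ (D⁻ w∈)) (proj₂ (D⁻ w∈)) (attached gy (proj₁ (D⁻ w∈)))

        result : TwoColouring (b 0) C i j
        result with bipartite D (smaller (restrict-⊂ C (¬? ∘ Near?) v∈ λ b≁v → b≁v bv))
                      gy′ (≤-trans p≤k (m≤n+m k 1)) j i (i≢j ∘ sym)
        ... | c , two , proper , first =
          merge Near? (const i) c ,
          merge-satisfies {C} Near? {Q = λ m → m ≡ i ⊎ m ≡ j} (λ _ _ → inj₁ refl) (swap ∘ two) ,
          merge-proper {C} Near?
            (λ u∈ bu _ bw uw → contradiction uw (neighbours-stable gy u∈ bu bw)) proper
            -- By twinness `w` is also a neighbour of `v`, the new path end, so the recursive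
            -- colouring gives it `j`.
            (λ u∈ bu w∈ b≁w uw eq → i≢j (trans eq
              (first (∈-restrict⁺ C (¬? ∘ Near?) w∈ b≁w) (neighbours-twins gy p≤k u∈ bu v∈ bv w∈ uw)))) ,
          on-near
          where
          on-near : ∀ {u} → u ∈ C → b 0 ~ u → merge Near? (const i) c u ≡ i
          on-near {u} _ bu with Near? u
          ... | yes _  = refl
          ... | no b≁u = contradiction bu b≁u

      -- Here `m` bounds the number of extensions still to be made. Each costs one colour, shared by
      -- all neighbours of the current end, and the bipartite remainder costs two. Different
      -- components of the rest are entered separately but use the same palette.
      gyárfás-colourable : ∀ m {k b C} → Gyárfás k b C → p ≤ m + k → ColourableOn C (m + 2)
      gyárfás-colourable zero {C = C} gy p≤k
        with bipartite C (⊂-wellFounded C) gy p≤k 0 1 (λ ())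
      ... | c , two , proper , _ = c , bound ∘ two , proper
        where
        bound : ∀ {i} → i ≡ 0 ⊎ i ≡ 1 → i < 2
        bound (inj₁ refl) = z<s
        bound (inj₂ refl) = s<s z<s
      gyárfás-colourable (suc m) {k} {b} {C} gy p≤ =
        colour-stable Near? (λ u∈ bu _ bv → neighbours-stable gy u∈ bu bv)
          (colour-components D (m + 2) colour)
        where
        Near? : Decidable (b 0 ~_)
        Near? = adj? G (b 0)

        D : Subset n
        D = restrict C (¬? ∘ Near?)

        D⁻ : ∀ {w} → w ∈ D → w ∈ C × b 0 ≁ w
        D⁻ = ∈-restrict⁻ C (¬? ∘ Near?)

        -- Going back along the attachment, vertices not adjacent to `b 0` stay in the component by
        -- closedness, until a neighbour `u` of `b 0` with a neighbour `t` in the component appears.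
        entrance : ∀ {v A w} → Component D v A → w ∈ A → Attached C (b 0) w →
          ∃ λ u → ∃ λ t → u ∈ C × b 0 ~ u × u ~ t × t ∈ A
        entrance comp w∈ (near bw) = contradiction bw (proj₂ (D⁻ (⊆-ambient comp w∈)))
        entrance comp w∈ (far {u} att u∈ uw) with Near? u
        ... | yes bu = u , _ , u∈ , bu , uw , w∈
        ... | no b≁u = entrance comp (closed comp w∈ (∈-restrict⁺ C (¬? ∘ Near?) u∈ b≁u) (~-sym uw)) att

        colour : ∀ {v A} → Component D v A → ColourableOn A (m + 2)
        colour comp
          with entrance comp (root∈ comp) (attached gy (proj₁ (D⁻ (⊆-ambient comp (root∈ comp)))))
        ... | u , t , u∈ , bu , ut , t∈ =
          gyárfás-colourable m
            (extend gy u∈ bu (D⁻ ∘ ⊆-ambient comp) λ w∈ →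
              attached-walk (near ut) (walk-sym (connected comp t∈) ◅◅ connected comp w∈))
            (subst (p ≤_) (sym (+-suc m k)) p≤)

      triangle-free-component-colourable : ∀ {S v A} → Component S v A →
        (∀ {u} → u ∈ A → ¬ InTriangle u) → ColourableOn A (p + 3)
      triangle-free-component-colourable {S} {v} {A} comp triangle-free =
        subst (ColourableOn A) (sym (+-suc p 2))
          (colour-stable (v ≟ᶠ_) (λ { _ refl _ refl → irrefl G })
            -- With a path of one vertex, `p - 1` extensions would do; allowing `p` avoids a
            -- predecessor. This gives `p + 2` colours, and the root takes one more.
            (gyárfás-colourable p start (m≤m+n p 1)))
        where
        C : Subset n
        C = restrict A (¬? ∘ (v ≟ᶠ_))

        -- The walk back to the root is cut at its first visit to `v`, so its intermediate vertices
        -- lie in `C`.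
        attach : ∀ {w} → WalkIn A w v → w ∈ C → Attached C v w
        attach ε w∈ = contradiction refl (proj₂ (∈-restrict⁻ A (¬? ∘ (v ≟ᶠ_)) w∈))
        attach (_◅_ {j = u} (wu , _ , u∈) walk) w∈ with v ≟ᶠ u
        ... | yes refl = near (~-sym wu)
        ... | no v≢u   =
          let u∈C = ∈-restrict⁺ A (¬? ∘ (v ≟ᶠ_)) u∈ v≢u in far (attach walk u∈C) u∈C (~-sym wu)

        start : Gyárfás 1 (const v) C
        start = record
          { distinct     = λ { () (s≤s z≤n) }
          ; consecutive  = λ { (s≤s ()) }
          ; chordless    = λ { () (s≤s z≤n) }
          ; outside      = λ w∈ _ w≡v → proj₂ (∈-restrict⁻ A (¬? ∘ (v ≟ᶠ_)) w∈) (sym w≡v)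
          ; anticomplete = λ { _ (s≤s ()) }
          ; attached     = λ w∈ →
              attach (walk-sym (connected comp (proj₁ (∈-restrict⁻ A (¬? ∘ (v ≟ᶠ_)) w∈)))) w∈
          ; no-triangle  = triangle-free ∘ proj₁ ∘ ∈-restrict⁻ A (¬? ∘ (v ≟ᶠ_))
          }

  -- The bound on the chromatic number.

  paw-T₁-free-colourable : ∀ {p d t} → G isFreeOf paw → G isFreeOf T₁ p →
    ¬ ContainsSubgraph G (K d t) → Colourable G (p + 3 + d * t)
  paw-T₁-free-colourable {p} {d} {t} paw-free T₁-free K-free =
    colourableOn-⊤ (colour-components ⊤ (p + 3 + d * t) colour)
    where
    colour : ∀ {v A} → Component ⊤ v A → ColourableOn A (p + 3 + d * t)
    colour {v} {A} comp with inTriangle? v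
    -- Being in a triangle spreads along walks, so the root decides for the whole component; the sum
    -- of the two bounds covers either case.
    ... | no ¬tri = colourableOn-mono (m≤m+n (p + 3) (d * t))
      (triangle-free-component-colourable T₁-free comp λ u∈ tri →
        ¬tri (inTriangle-walk paw-free tri (walk-sym (connected comp u∈))))
    ... | yes tri
      with multipartite-colourable-or-clique (d * t) A (component-with-triangle paw-free comp tri)
    ...   | inj₁ col    = colourableOn-mono (m≤n+m (d * t) (p + 3)) col
    ...   | inj₂ clique = contradiction (clique⇒K clique) K-free

theorem8 : (p : ℕ) → 4 ≤ p → (d : ℕ) → 1 ≤ d →
    Σ Polynomial λ f →
    (t : ℕ) → 1 ≤ t →
    (n : ℕ) (G : Graph (Fin n)) →
    G isFreeOf paw →
    G isFreeOf T₁ p →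
    ¬ ContainsSubgraph G (K d t) →
    (+ χ G) ≤ℤ eval f (+ t)
-- The polynomial is linear in `t`: constant term `p + 3` for triangle-free components, slope `d`
-- for the `d * t` parts of a multipartite one.
theorem8 p _ d _ = + (p + 3) ∷ + d ∷ [] , bound
  where
  eval-linear : ∀ t → eval (+ (p + 3) ∷ + d ∷ []) (+ t) ≡ + (p + 3 + d * t)
  eval-linear t = cong (λ i → + (p + 3) +ℤ i) (begin
    + t *ℤ (+ d +ℤ + t *ℤ + 0) ≡⟨ cong (λ i → + t *ℤ (+ d +ℤ i)) (*ℤ-zeroʳ (+ t)) ⟩
    + t *ℤ + (d + 0)           ≡⟨ pos-* t (d + 0) ⟨
    + (t * (d + 0))            ≡⟨ cong (λ m → + (t * m)) (+-identityʳ d) ⟩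
    + (t * d)                  ≡⟨ cong +_ (*-comm t d) ⟩
    + (d * t)                  ∎)
    where open ≡-Reasoning

  bound : ∀ t → 1 ≤ t → ∀ n (G : Graph (Fin n)) → G isFreeOf paw → G isFreeOf T₁ p →
    ¬ ContainsSubgraph G (K d t) → (+ χ G) ≤ℤ eval (+ (p + 3) ∷ + d ∷ []) (+ t)
  bound t _ n G paw-free T₁-free K-free = subst ((+ χ G) ≤ℤ_) (sym (eval-linear t))
    (+≤+ (proj₂ (χ-isChromaticNumber G) _ (paw-T₁-free-colourable G paw-free T₁-free K-free)))
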